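{- Let $N>0$ be an integer. There is no integer $C$ such that for every integer $n\ge 0$ there exists an integer index $j\ge 0$ (depending on $n$ and $N$) with $$\sum_{i=0}^{4N-1} F(n+i) = C\cdot F(j).$$
   Context: The Fibonacci numbers are defined by $F(0)=0$, $F(1)=1$, $F(n)=F(n-1)+F(n-2)$ for $n\ge 2$. -}

module Defs where

open import Data.Nat using (ℕ; zero; suc; _+_)

F : ℕ → ℕ
F zero          = 0
F (suc zero)    = 1
F (suc (suc n)) = F (suc n) + F n

{-# OPTIONS --safe #-}
-- Put a = F(2N) and b = F(2N+1).  Telescoping, the duplication formulas and
-- Cassini's identity b² = ab + a² + 1 give the values S₀ = a(2a + b) and
-- S₁ = a(a + 3b) of the sum at n = 0 and n = 1.  If S₀ = C F(j) and
-- S₁ = C F(k), then S₀ < S₁ < 2 S₀ and 2 F(j) ≤ F(j+2) force k = j + 1.  The form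
-- y² - xy - x² takes the value 5a² at (S₀ , S₁) and ± C² at (C F(j) , C F(j+1)),
-- so C² = 5a² with a > 0, contradicting the irrationality of √5.
module Submission where

open import Defs
open import Data.Nat using (ℕ; zero; suc; _+_; _*_; _>_; _<_; _≤_; z≤n; s≤s; NonZero; >-nonZero)
open import Data.Nat.ListAction using (sum)
open import Data.Nat.Properties
open import Data.Nat.Divisibility using (_∣_; divides; m∣m*n)
open import Data.Nat.Induction using (<-rec)
open import Data.Nat.Primality using (Prime; prime?; euclidsLemma)
open import Data.Nat.Tactic.RingSolver using (solve-∀; solve)
open import Data.List using (map; upTo; applyUpTo; []; _∷_)
open import Data.List.Properties using (map-upTo)
open import Data.Integer as ℤ using (ℤ; +_; ∣_∣)
open import Data.Integer.Properties using (abs-*)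
open import Data.Empty using (⊥)
open import Data.Product using (Σ-syntax; _,_)
open import Data.Sum using (_⊎_; inj₁; inj₂; [_,_]′)
open import Function using (id; _∘_)
open import Relation.Nullary using (¬_; contradiction)
open import Relation.Nullary.Decidable using (from-yes)
open import Relation.Binary.PropositionalEquality
  using (_≡_; refl; sym; trans; cong; subst; module ≡-Reasoning)

-- Telescoping sums and the growth of `F`.

-- The head `f 0` merges with `f 1` into `f 2`, leaving the same claim for `f ∘ suc`. This is why
-- `f` is any sequence obeying the recurrence.
sum-telescope : (f : ℕ → ℕ) → (∀ i → f (2 + i) ≡ f (1 + i) + f i) →
  ∀ k → sum (applyUpTo f k) + f 1 ≡ f (suc k)
sum-telescope f rec zero    = refl
sum-telescope f rec (suc k) = begin
  f 0 + s + f 1    ≡⟨ rearrange (f 0) s (f 1) ⟩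
  s + (f 1 + f 0)  ≡⟨ cong (_+_ s) (rec 0) ⟨
  s + f 2          ≡⟨ sum-telescope (f ∘ suc) (rec ∘ suc) k ⟩
  f (2 + k)        ∎
  where
  open ≡-Reasoning
  s = sum (applyUpTo (f ∘ suc) k)
  rearrange : ∀ x y z → x + y + z ≡ y + (z + x)
  rearrange = solve-∀

F-step : ∀ n → F n ≤ F (suc n)
F-step zero    = z≤n
F-step (suc n) = m≤m+n (F (suc n)) (F n)

F-mono : ∀ m {n} → m ≤ n → F m ≤ F n
F-mono m {n} m≤n with m≤n⇒m<n∨m≡n m≤n
... | inj₂ refl      = ≤-refl
... | inj₁ (s≤s {n = n′} m≤n′) = ≤-trans (F-mono m m≤n′) (F-step n′)

F-pos : ∀ n → 0 < F (suc n)
F-pos n = F-mono 1 {suc n} (s≤s z≤n)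

2*F≤F : ∀ n → 2 * F n ≤ F (2 + n)
2*F≤F n = ≤-trans (≤-reflexive (cong (_+_ (F n)) (+-identityʳ (F n))))
                  (+-monoˡ-≤ (F n) (F-step n))

-- Positivity rules out `n = 0`, where `F 1 = 1` exceeds `2 * F 0 = 0`.
F-suc≤2*F : ∀ n → 0 < F n → F (suc n) ≤ 2 * F n
F-suc≤2*F (suc n) _ = ≤-trans (+-monoʳ-≤ (F (suc n)) (F-step n))
  (≤-reflexive (cong (_+_ (F (suc n))) (sym (+-identityʳ (F (suc n))))))

-- Addition formula and Cassini's identity.

F-add : ∀ m n → F (suc (m + n)) ≡ F (suc m) * F (suc n) + F m * F n
F-add zero    n = sym (trans (+-identityʳ _) (*-identityˡ _))
F-add (suc m) n = begin
  F (suc (suc m + n))                                ≡⟨ cong (F ∘ suc) (+-suc m n) ⟨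
  F (suc (m + suc n))                                ≡⟨ F-add m (suc n) ⟩
  F (suc m) * (F (suc n) + F n) + F m * F (suc n)    ≡⟨ rearrange (F (suc m)) (F m) (F (suc n)) (F n) ⟩
  (F (suc m) + F m) * F (suc n) + F (suc m) * F n    ∎
  where
  open ≡-Reasoning
  rearrange : ∀ p q r s → p * (r + s) + q * r ≡ (p + q) * r + p * s
  rearrange = solve-∀

-- The form y² - xy - x² takes the value 1 or -1; one predicate per sign avoids subtraction in `ℕ`.
CassiniPlus CassiniMinus : ℕ → ℕ → Set
CassiniPlus  x y = y * y ≡ y * x + x * x + 1
CassiniMinus x y = y * y + 1 ≡ y * x + x * x

-- Passing from (x, y) to (y, y + x) negates the form y² - xy - x².
cassini-step⁺ : ∀ x y → CassiniPlus x y → CassiniMinus y (y + x)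
cassini-step⁺ x y eq = begin
  (y + x) * (y + x) + 1            ≡⟨ expand x y ⟩
  y * y + x * y + (y * x + x * x + 1) ≡⟨ cong (_+_ (y * y + x * y)) eq ⟨
  y * y + x * y + y * y            ≡⟨ collect x y ⟩
  (y + x) * y + y * y              ∎
  where
  open ≡-Reasoning
  expand : ∀ x y → (y + x) * (y + x) + 1 ≡ y * y + x * y + (y * x + x * x + 1)
  expand = solve-∀
  collect : ∀ x y → y * y + x * y + y * y ≡ (y + x) * y + y * y
  collect = solve-∀

cassini-step⁻ : ∀ x y → CassiniMinus x y → CassiniPlus y (y + x)
cassini-step⁻ x y eq = begin
  (y + x) * (y + x)                ≡⟨ expand x y ⟩
  y * y + x * y + (y * x + x * x)  ≡⟨ cong (_+_ (y * y + x * y)) eq ⟨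
  y * y + x * y + (y * y + 1)      ≡⟨ collect x y ⟩
  (y + x) * y + y * y + 1          ∎
  where
  open ≡-Reasoning
  expand : ∀ x y → (y + x) * (y + x) ≡ y * y + x * y + (y * x + x * x)
  expand = solve-∀
  collect : ∀ x y → y * y + x * y + (y * y + 1) ≡ (y + x) * y + y * y + 1
  collect = solve-∀

cassini : ∀ n → CassiniPlus (F n) (F (suc n)) ⊎ CassiniMinus (F n) (F (suc n))
cassini zero    = inj₁ refl
cassini (suc n) with cassini n
... | inj₁ p = inj₂ (cassini-step⁺ (F n) (F (suc n)) p)
... | inj₂ p = inj₁ (cassini-step⁻ (F n) (F (suc n)) p)

-- Two steps restore the sign. With the index written `n * 2`, the successor case reduces to
-- `2 + n * 2` by computation.
cassini-even : ∀ n → CassiniPlus (F (n * 2)) (F (suc (n * 2)))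
cassini-even zero    = refl
cassini-even (suc n) =
  cassini-step⁻ (F (1 + n * 2)) (F (2 + n * 2)) (cassini-step⁺ (F (n * 2)) (F (1 + n * 2)) (cassini-even n))

-- Irrationality of √5 by infinite descent.

5-prime : Prime 5
5-prime = from-yes (prime? 5)

-- Primality of 5 gives c = 5e, hence a² = 5e², hence a = 5b and e² = 5b². So (e, b) is a solution
-- with b < a; since c changes too, `P` quantifies over it.
√5-irrational : ∀ c a → c * c ≡ 5 * (a * a) → ¬ 0 < a
√5-irrational c a = <-rec P descend a c
  where
  P : ℕ → Set
  P a = ∀ c → c * c ≡ 5 * (a * a) → ¬ 0 < a

  5∣ : ∀ x k → x * x ≡ 5 * k → 5 ∣ x
  5∣ x k eq = [ id , id ]′ (euclidsLemma x x 5-prime (subst (5 ∣_) (sym eq) (m∣m*n k)))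

  pull : ∀ e → e * 5 * (e * 5) ≡ 5 * (5 * (e * e))
  pull = solve-∀

  descend : ∀ a → (∀ {b} → b < a → P b) → P a
  descend a ih c eq 0<a with 5∣ c (a * a) eq
  ... | divides e refl with *-cancelˡ-≡ (a * a) (5 * (e * e)) 5 (trans (sym eq) (pull e))
  ... | eq₁ with 5∣ a (e * e) eq₁
  ... | divides zero      refl = contradiction 0<a λ ()
  ... | divides b@(suc _) refl =
    ih (m<m*n b 5 (s≤s (s≤s z≤n))) e
       (*-cancelˡ-≡ (e * e) (5 * (b * b)) 5 (trans (sym eq₁) (pull b))) (s≤s z≤n)

-- Monotonicity of `F` excludes k ≤ j; for k ≥ j + 2 the value would already have doubled.
indices-consecutive : ∀ c j k →
  c * F j < c * F k → c * F k < 2 * (c * F j) → k ≡ suc j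
indices-consecutive c j k lt gt = ≤-antisym k≤1+j j<k
  where
  j<k : j < k
  j<k = ≰⇒> λ k≤j → <⇒≱ lt (*-monoʳ-≤ c (F-mono k k≤j))

  swap : ∀ c x → 2 * (c * x) ≡ c * (2 * x)
  swap = solve-∀

  k≤1+j : k ≤ suc j
  k≤1+j = ≮⇒≥ λ 1+j<k → <⇒≱ gt
    (≤-trans (≤-reflexive (swap c (F j)))
             (*-monoʳ-≤ c (≤-trans (2*F≤F j) (F-mono (2 + j) 1+j<k))))

-- The sums at n = 0 and n = 1.

module _ (N : ℕ) where
  private
    a = F (N * 2)
    b = F (suc (N * 2))

  fibSum : ℕ → ℕ
  fibSum n = sum (map (λ i → F (n + i)) (upTo (4 * N)))

  4*N : 4 * N ≡ N * 2 + N * 2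
  4*N = solve (N ∷ [])

  -- The recurrence is a hypothesis because `n + (2 + i)` does not reduce for a variable `n`; at 0
  -- and 1 it holds by `refl`.
  fibSum-telescope : ∀ n → (∀ i → F (n + (2 + i)) ≡ F (n + (1 + i)) + F (n + i)) →
    fibSum n + F (n + 1) ≡ F (n + suc (4 * N))
  fibSum-telescope n rec =
    trans (cong (λ l → sum l + F (n + 1)) (map-upTo (λ i → F (n + i)) (4 * N)))
          (sum-telescope (λ i → F (n + i)) rec (4 * N))

  fibSum₀ : fibSum 0 ≡ a * (2 * a + b)
  -- The cancelled 1 is `F 1`, matched by the 1 in Cassini's identity.
  fibSum₀ = +-cancelʳ-≡ 1 (fibSum 0) (a * (2 * a + b)) (begin
    fibSum 0 + 1                 ≡⟨ fibSum-telescope 0 (λ _ → refl) ⟩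
    F (suc (4 * N))              ≡⟨ cong (F ∘ suc) 4*N ⟩
    F (suc (N * 2 + N * 2))      ≡⟨ F-add (N * 2) (N * 2) ⟩
    b * b + a * a                ≡⟨ cong (_+ a * a) (cassini-even N) ⟩
    b * a + a * a + 1 + a * a    ≡⟨ rearrange a b ⟩
    a * (2 * a + b) + 1          ∎)
    where
    open ≡-Reasoning
    rearrange : ∀ a b → b * a + a * a + 1 + a * a ≡ a * (2 * a + b) + 1
    rearrange = solve-∀

  fibSum₁ : fibSum 1 ≡ a * (a + 3 * b)
  -- Here the cancelled 1 is `F 2`.
  fibSum₁ = +-cancelʳ-≡ 1 (fibSum 1) (a * (a + 3 * b)) (begin
    fibSum 1 + 1                           ≡⟨ fibSum-telescope 1 (λ _ → refl) ⟩
    F (2 + 4 * N)                          ≡⟨ cong (λ m → F (2 + m)) 4*N ⟩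
    F (suc (suc (N * 2) + N * 2))          ≡⟨ F-add (suc (N * 2)) (N * 2) ⟩
    (b + a) * b + b * a                    ≡⟨ expand a b ⟩
    b * b + 2 * (a * b)                    ≡⟨ cong (_+ 2 * (a * b)) (cassini-even N) ⟩
    b * a + a * a + 1 + 2 * (a * b)        ≡⟨ rearrange a b ⟩
    a * (a + 3 * b) + 1                    ∎)
    where
    open ≡-Reasoning
    expand : ∀ a b → (b + a) * b + b * a ≡ b * b + 2 * (a * b)
    expand = solve-∀
    rearrange : ∀ a b → b * a + a * a + 1 + 2 * (a * b) ≡ a * (a + 3 * b) + 1
    rearrange = solve-∀

  fibSum-form : fibSum 1 * fibSum 1 ≡ fibSum 1 * fibSum 0 + fibSum 0 * fibSum 0 + 5 * (a * a)
  fibSum-form rewrite fibSum₀ | fibSum₁ = begin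
    a * (a + 3 * b) * (a * (a + 3 * b))
      -- The target keeps 4b², so only five of the nine copies of b² are replaced by Cassini's
      -- identity.
      ≡⟨ expand a b ⟩
    a * a * (a * a + 6 * (a * b) + 4 * (b * b) + 5 * (b * b))
      ≡⟨ cong (λ t → a * a * (a * a + 6 * (a * b) + 4 * (b * b) + 5 * t)) (cassini-even N) ⟩
    a * a * (a * a + 6 * (a * b) + 4 * (b * b) + 5 * (b * a + a * a + 1))
      ≡⟨ collect a b ⟩
    a * (a + 3 * b) * (a * (2 * a + b)) + a * (2 * a + b) * (a * (2 * a + b)) + 5 * (a * a)
      ∎
    where
    open ≡-Reasoning
    expand : ∀ a b → a * (a + 3 * b) * (a * (a + 3 * b))
      ≡ a * a * (a * a + 6 * (a * b) + 4 * (b * b) + 5 * (b * b))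
    expand = solve-∀
    collect : ∀ a b → a * a * (a * a + 6 * (a * b) + 4 * (b * b) + 5 * (b * a + a * a + 1))
      ≡ a * (a + 3 * b) * (a * (2 * a + b)) + a * (2 * a + b) * (a * (2 * a + b)) + 5 * (a * a)
    collect = solve-∀

  module _ (0<a : 0 < a) where
    private instance
      a≢0 : NonZero a
      a≢0 = >-nonZero 0<a

    fibSum₀<fibSum₁ : fibSum 0 < fibSum 1
    fibSum₀<fibSum₁ rewrite fibSum₀ | fibSum₁ = *-monoʳ-< a (begin-strict
      2 * a + b      ≡⟨ split a b ⟩
      a + (a + b)    ≤⟨ +-monoʳ-≤ a (+-monoˡ-≤ b (F-step (N * 2))) ⟩
      a + (b + b)    <⟨ m<m+n (a + (b + b)) (F-pos (N * 2)) ⟩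
      a + (b + b) + b ≡⟨ collect a b ⟩
      a + 3 * b      ∎)
      where
      open ≤-Reasoning
      split : ∀ a b → 2 * a + b ≡ a + (a + b)
      split = solve-∀
      collect : ∀ a b → a + (b + b) + b ≡ a + 3 * b
      collect = solve-∀

    fibSum₁<2*fibSum₀ : fibSum 1 < 2 * fibSum 0
    fibSum₁<2*fibSum₀ rewrite fibSum₀ | fibSum₁ = begin-strict
      a * (a + 3 * b)             <⟨ *-monoʳ-< a bound ⟩
      a * (2 * (2 * a + b))       ≡⟨ swap a (2 * a + b) ⟩
      2 * (a * (2 * a + b))       ∎
      where
      open ≤-Reasoning
      swap : ∀ c x → c * (2 * x) ≡ 2 * (c * x)
      swap = solve-∀
      split : ∀ a b → a + 3 * b ≡ b + (a + 2 * b)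
      split = solve-∀
      collect : ∀ a b → 2 * a + (a + 2 * b) + a ≡ 2 * (2 * a + b)
      collect = solve-∀
      -- The difference of the two sides is 3a - b, positive because b ≤ 2a and a > 0.
      bound : a + 3 * b < 2 * (2 * a + b)
      bound = begin-strict
        a + 3 * b                  ≡⟨ split a b ⟩
        b + (a + 2 * b)            ≤⟨ +-monoˡ-≤ (a + 2 * b) (F-suc≤2*F (N * 2) 0<a) ⟩
        2 * a + (a + 2 * b)        <⟨ m<m+n (2 * a + (a + 2 * b)) 0<a ⟩
        2 * a + (a + 2 * b) + a    ≡⟨ collect a b ⟩
        2 * (2 * a + b)            ∎

-- Comparing values of the quadratic form.

-- Scaling both arguments by c multiplies the form by c².
scaled-cassini⁺ : ∀ c x y t → CassiniPlus x y →
  c * y * (c * y) ≡ c * y * (c * x) + c * x * (c * x) + t → c * c ≡ t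
scaled-cassini⁺ c x y t eq form = +-cancelˡ-≡ (c * y * (c * x) + c * x * (c * x)) (c * c) t (begin
  c * y * (c * x) + c * x * (c * x) + c * c    ≡⟨ collect c x y ⟩
  c * c * (y * x + x * x + 1)                  ≡⟨ cong (_*_ (c * c)) eq ⟨
  c * c * (y * y)                              ≡⟨ square c y ⟩
  c * y * (c * y)                              ≡⟨ form ⟩
  c * y * (c * x) + c * x * (c * x) + t        ∎)
  where
  open ≡-Reasoning
  collect : ∀ c x y → c * y * (c * x) + c * x * (c * x) + c * c ≡ c * c * (y * x + x * x + 1)
  collect = solve-∀
  square : ∀ c y → c * c * (y * y) ≡ c * y * (c * y)
  square = solve-∀

-- With the opposite sign, t + c² = 0, which in `ℕ` forces both terms to vanish.
scaled-cassini⁻ : ∀ c x y t → CassiniMinus x y →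
  c * y * (c * y) ≡ c * y * (c * x) + c * x * (c * x) + t → t ≡ 0
scaled-cassini⁻ c x y t eq form = m+n≡0⇒m≡0 t (+-cancelˡ-≡ s (t + c * c) 0 (begin
  s + (t + c * c)              ≡⟨ +-assoc s t (c * c) ⟨
  s + t + c * c                ≡⟨ cong (_+ c * c) form ⟨
  c * y * (c * y) + c * c      ≡⟨ square c y ⟩
  c * c * (y * y + 1)          ≡⟨ cong (_*_ (c * c)) eq ⟩
  c * c * (y * x + x * x)      ≡⟨ collect c x y ⟩
  s + 0                        ∎))
  where
  open ≡-Reasoning
  s = c * y * (c * x) + c * x * (c * x)
  square : ∀ c y → c * y * (c * y) + c * c ≡ c * c * (y * y + 1)
  square = solve-∀
  collect : ∀ c x y → c * c * (y * x + x * x) ≡ c * y * (c * x) + c * x * (c * x) + 0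
  collect = solve-∀

no-common-factor : ∀ N c j k → 0 < F (N * 2) →
  fibSum N 0 ≡ c * F j → fibSum N 1 ≡ c * F k → ⊥
no-common-factor N c j k 0<a eq₀ eq₁
  with fibSum₀<fibSum₁ N 0<a | fibSum₁<2*fibSum₀ N 0<a | fibSum-form N
... | lt | gt | form
  -- This turns `form` into a statement about `c * F j` and `c * F (suc j)`.
  rewrite eq₀ | eq₁ | indices-consecutive c j k lt gt
  with cassini j
... | inj₁ p = √5-irrational c a (scaled-cassini⁺ c (F j) (F (suc j)) (5 * (a * a)) p form) 0<a
  where a = F (N * 2)
-- The negative sign would give 5a² = 0, against a > 0.
... | inj₂ p = <⇒≢ (*-mono-< {0} {5} (s≤s z≤n) (*-mono-< 0<a 0<a))
    (sym (scaled-cassini⁻ c (F j) (F (suc j)) (5 * (a * a)) p form))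
  where a = F (N * 2)

theorem5p2 : (N : ℕ) → N > 0 →
    ¬ (Σ[ C ∈ ℤ ] ((n : ℕ) → Σ[ j ∈ ℕ ]
    + sum (map (λ i → F (n + i)) (upTo (4 * N))) ≡ C ℤ.* + F j))
theorem5p2 N@(suc M) _ (C , h) with h 0 | h 1
... | j , eq₀ | k , eq₁ = no-common-factor N ∣ C ∣ j k (F-pos (suc (M * 2)))
  -- Absolute values move both equations to `ℕ` with factor `∣ C ∣`, so the sign of `C` needs no
  -- case split.
  (trans (cong ∣_∣ eq₀) (abs-* C (+ F j)))
  (trans (cong ∣_∣ eq₁) (abs-* C (+ F k)))
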